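{- Let $U$ be an infinite set and let $p$ be a modal formula. 1. If $p$ is valid in every finite frame $\langle W,R\rangle$ with $W\subseteq U$, then $\varnothing\vdash p$. 2. If $p$ is valid in every finite reflexive frame $\langle W,R\rangle$ with $W\subseteq U$, then $\mathcal{T}\vdash p$. 3. If $p$ is valid in every finite transitive frame $\langle W,R\rangle$ with $W\subseteq U$, then $\mathcal{K}4\vdash p$. 4. If $p$ is valid in every finite irreflexive transitive frame $\langle W,R\rangle$ with $W\subseteq U$, then $\mathcal{GL}\vdash p$.
   Context: Syntax. Atoms are finite character strings. Modal formulas: $p ::= \bot\mid\top\mid a\mid\neg p\mid p\land q\mid p\lor q\mid p\to q\mid p\leftrightarrow q\mid\Box p$, with $a$ an atom and all connectives primitive. Semantics. A frame is a pair $\langle W,R\rangle$ with $W$ a nonempty set and $R\subseteq W\times W$; it is finite iff $W$ is. Given a valuation $V$ (a relation between atoms and worlds), forcing at a world $w\in W$ is defined classically for the propositional connectives, atoms are forced according to $V$, and $\Box p$ is forced at $w$ iff $p$ is forced at every $w'\in W$ with $wRw'$. $p$ is valid in $\langle W,R\rangle$ if it is forced at every $w\in W$ under every valuation. A frame is reflexive, irreflexive or transitive iff $R$ is so on $W$. Deducibility. For a set $\mathcal{S}$ of formulas, $\mathcal{S}\vdash p$ means that $p$ belongs to the smallest set of formulas containing $\mathcal{S}$ and all formulas of the following forms, and closed under modus ponens and necessitation (from $p$ infer $\Box p$): $p\to(q\to p)$; $(p\to q\to r)\to(p\to q)\to(p\to r)$; $((p\to\bot)\to\bot)\to p$; $(p\leftrightarrow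 q)\to p\to q$; $(p\leftrightarrow q)\to q\to p$; $(p\to q)\to(q\to p)\to(p\leftrightarrow q)$; $\top\leftrightarrow(\bot\to\bot)$; $\neg p\leftrightarrow(p\to\bot)$; $(p\land q)\leftrightarrow((p\to q\to\bot)\to\bot)$; $(p\lor q)\leftrightarrow\neg(\neg p\land\neg q)$; $\Box(p\to q)\to\Box p\to\Box q$. $\mathcal{T}$ is the set of all formulas $\Box p\to p$; $\mathcal{K}4$ the set of all formulas $\Box p\to\Box\Box p$; $\mathcal{GL}$ the set of all formulas $\Box(\Box p\to p)\to\Box p$. -}

module Defs where

open import Level using (Level; suc; 0ℓ)
open import Data.Empty.Polymorphic using (⊥)
open import Data.List.Base using (List; []; _∷_)
import Data.List.Membership.Propositional as List
open import Data.List.Relation.Unary.All as All using (All; []; _∷_)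
open import Data.Product using (_×_; _,_; proj₂; ∃-syntax)
open import Data.String using (String)
open import Data.Sum using (_⊎_)
open import Data.Unit.Polymorphic using (⊤; tt)
open import Function.Bundles using (_⇔_; mk⇔; module Equivalence)
open import Relation.Binary.Core using (Rel)
open import Relation.Binary.Definitions using (Transitive; Irreflexive)
open import Relation.Binary.PropositionalEquality using (_≡_)
open import Relation.Nullary using (¬_; Dec; yes; no; ¬?; _×-dec_; _⊎-dec_; _→-dec_)
open import Relation.Nullary.Decidable using (map′)
open import Relation.Unary using (Pred; _∈_; Satisfiable)

private variable
  u : Level

------------------------------------------------------------------------
-- Syntax

infix  30 □_ ~_
infixr 25 _∧_
infixr 24 _∨_
infixr 23 _⊃_
infix  22 _↔_

data Formula : Set where
  ⊥′ ⊤′           : Formula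
  atom            : String → Formula
  ~_              : Formula → Formula
  _∧_ _∨_ _⊃_ _↔_ : Formula → Formula → Formula
  □_              : Formula → Formula

------------------------------------------------------------------------
-- Deducibility

infix 4 _⊢_

data _⊢_ (𝒮 : Pred Formula 0ℓ) : Pred Formula 0ℓ where
  hyp    : ∀ {p} → p ∈ 𝒮 → 𝒮 ⊢ p
  ax-K   : ∀ p q → 𝒮 ⊢ p ⊃ (q ⊃ p)
  ax-S   : ∀ p q r → 𝒮 ⊢ (p ⊃ q ⊃ r) ⊃ (p ⊃ q) ⊃ p ⊃ r
  ax-DN  : ∀ p → 𝒮 ⊢ ((p ⊃ ⊥′) ⊃ ⊥′) ⊃ p
  ax-↔ˡ  : ∀ p q → 𝒮 ⊢ (p ↔ q) ⊃ p ⊃ q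
  ax-↔ʳ  : ∀ p q → 𝒮 ⊢ (p ↔ q) ⊃ q ⊃ p
  ax-↔   : ∀ p q → 𝒮 ⊢ (p ⊃ q) ⊃ (q ⊃ p) ⊃ (p ↔ q)
  ax-⊤   : 𝒮 ⊢ ⊤′ ↔ (⊥′ ⊃ ⊥′)
  ax-~   : ∀ p → 𝒮 ⊢ ~ p ↔ (p ⊃ ⊥′)
  ax-∧   : ∀ p q → 𝒮 ⊢ (p ∧ q) ↔ ((p ⊃ q ⊃ ⊥′) ⊃ ⊥′)
  ax-∨   : ∀ p q → 𝒮 ⊢ (p ∨ q) ↔ ~ (~ p ∧ ~ q)
  ax-□   : ∀ p q → 𝒮 ⊢ □ (p ⊃ q) ⊃ □ p ⊃ □ q
  mp     : ∀ {p q} → 𝒮 ⊢ p ⊃ q → 𝒮 ⊢ p → 𝒮 ⊢ q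
  nec    : ∀ {p} → 𝒮 ⊢ p → 𝒮 ⊢ □ p

data 𝒯 : Pred Formula 0ℓ where
  ax-T : ∀ p → 𝒯 (□ p ⊃ p)

data 𝒦4 : Pred Formula 0ℓ where
  ax-4 : ∀ p → 𝒦4 (□ p ⊃ □ □ p)

data 𝒢ℒ : Pred Formula 0ℓ where
  ax-GL : ∀ p → 𝒢ℒ (□ (□ p ⊃ p) ⊃ □ p)

------------------------------------------------------------------------
-- Semantics

-- A frame ⟨W,R⟩ with W ⊆ U.  The fields R? here and V? below are vacuous
-- classically.  Constructively they are what makes the connectives classical:
-- see ⊩-dec.

record Frame (U : Set u) : Set (suc u) where
  field
    W        : Pred U u
    R        : Rel U u
    nonempty : Satisfiable W
    R⊆W×W    : ∀ {w w′} → R w w′ → w ∈ W × w′ ∈ W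
    R?       : ∀ {w w′} → w ∈ W → w′ ∈ W → Dec (R w w′)

record Valuation {U : Set u} (F : Frame U) : Set (suc u) where
  open Frame F
  field
    V  : String → Pred U u
    V? : ∀ a {w} → w ∈ W → Dec (V a w)

module _ {U : Set u} {F : Frame U} (𝒱 : Valuation F) where
  open Frame F
  open Valuation 𝒱

  infix 4 _⊩_

  _⊩_ : U → Formula → Set u
  w ⊩ ⊥′     = ⊥
  w ⊩ ⊤′     = ⊤
  w ⊩ atom a = V a w
  w ⊩ ~ p    = ¬ (w ⊩ p)
  w ⊩ p ∧ q  = w ⊩ p × w ⊩ q
  w ⊩ p ∨ q  = w ⊩ p ⊎ w ⊩ q
  w ⊩ p ⊃ q  = w ⊩ p → w ⊩ q
  w ⊩ p ↔ q  = (w ⊩ p) ⇔ (w ⊩ q)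
  w ⊩ □ p    = ∀ {w′} → w′ ∈ W → R w w′ → w′ ⊩ p

infix 4 _⊨_

_⊨_ : {U : Set u} → Frame U → Formula → Set (suc u)
F ⊨ p = (𝒱 : Valuation F) → ∀ {w} → w ∈ Frame.W F → _⊩_ 𝒱 w p

module _ {U : Set u} (F : Frame U) where
  open Frame F

  IsFinite : Set u
  IsFinite = ∃[ ws ] ∀ w → w ∈ W ⇔ w List.∈ ws

  IsReflexive : Set u
  IsReflexive = ∀ {w} → w ∈ W → R w w

  -- As R ⊆ W × W, the next two hold on U iff they hold on W.

  IsTransitive : Set u
  IsTransitive = Transitive R

  IsIrreflexive : Set u
  IsIrreflexive = Irreflexive _≡_ R

-- On a finite frame forcing is decidable at every world.

module _ {U : Set u} {F : Frame U} (fin : IsFinite F) (𝒱 : Valuation F) where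
  open Frame F
  open Valuation 𝒱

  private
    W⇔ws = proj₂ fin

    all-dec : ∀ {P : Pred U u} {xs} → All (λ x → Dec (P x)) xs → Dec (All P xs)
    all-dec []       = yes []
    all-dec (d ∷ ds) = map′ (λ (x , xs) → x ∷ xs) (λ { (x ∷ xs) → x , xs })
                            (d ×-dec all-dec ds)

  ⊩-dec : ∀ {w} → w ∈ W → ∀ p → Dec (_⊩_ 𝒱 w p)
  ⊩-dec w∈W ⊥′       = no λ ()
  ⊩-dec w∈W ⊤′       = yes tt
  ⊩-dec w∈W (atom a) = V? a w∈W
  ⊩-dec w∈W (~ p)    = ¬? (⊩-dec w∈W p)
  ⊩-dec w∈W (p ∧ q)  = ⊩-dec w∈W p ×-dec ⊩-dec w∈W q
  ⊩-dec w∈W (p ∨ q)  = ⊩-dec w∈W p ⊎-dec ⊩-dec w∈W q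
  ⊩-dec w∈W (p ⊃ q)  = ⊩-dec w∈W p →-dec ⊩-dec w∈W q
  ⊩-dec w∈W (p ↔ q)  =
    map′ (λ (f , g) → mk⇔ f g) (λ e → Equivalence.to e , Equivalence.from e)
         ((⊩-dec w∈W p →-dec ⊩-dec w∈W q) ×-dec (⊩-dec w∈W q →-dec ⊩-dec w∈W p))
  ⊩-dec w∈W (□ p)    =
    map′ (λ h {w′} w′∈W → All.lookup h (Equivalence.to (W⇔ws w′) w′∈W))
         (λ h → All.tabulate λ {w′} i → h (Equivalence.from (W⇔ws w′) i))
         (all-dec (All.tabulate λ {w′} i →
           let w′∈W = Equivalence.from (W⇔ws w′) i in
           R? w∈W w′∈W →-dec ⊩-dec w′∈W p))

------------------------------------------------------------------------
-- Infinite sets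

-- U is not finite: no finite list exhausts it.  Membership is doubly negated
-- because equality on U need not be decidable (when it is, the double negation
-- can be dropped).  This is implied by an injection ℕ → U, and by injections
-- Fin n → U for all n.

Infinite : Set u → Set u
Infinite U = ¬ (∃[ xs ] ∀ (x : U) → ¬ ¬ (x List.∈ xs))

{-# OPTIONS --safe #-}

-- Pratt's type elimination.  A state assigns truth values to the atoms and boxed
-- formulas built from subformulas of p.  Starting from all states, repeatedly
-- discard those that falsify some □ q without having a surviving accessible state
-- that falsifies q; every discarded state is refutable in the logic.  If no survivor
-- falsifies p, then p is provable by cases over all states.  Otherwise the survivors
-- form a finite countermodel.  Since this dichotomy holds constructively, the
-- countermodel need be embedded in U only up to double negation.

module Submission where

open import Defs
open import Data.Bool.Base using (Bool; true; false; not; if_then_else_) renaming (_∧_ to _&&_; _∨_ to _||_)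
import Data.Bool.Properties as Bool
open import Data.Empty using (⊥-elim)
open import Data.Fin.Base using (Fin; zero; suc)
open import Data.List.Base using (List; []; _∷_; _++_; map; filter; length; lookup; tabulate)
open import Data.List.Membership.Propositional using (lose; find) renaming (_∈_ to _∈ˡ_)
open import Data.List.Membership.Propositional.Properties
  using (∈-++⁺ˡ; ∈-++⁺ʳ; ∈-++⁻; ∈-map⁺; ∈-filter⁺; ∈-lookup; ∈-tabulate⁺; ∈-tabulate⁻)
open import Data.List.Properties using (filter-notAll)
open import Data.List.Relation.Unary.All as All using (All; []; _∷_)
open import Data.List.Relation.Unary.All.Properties using (¬All⇒Any¬)
open import Data.List.Relation.Unary.Any as Any using (Any; here; there)
open import Data.List.Relation.Unary.Any.Properties using (lookup-index)
open import Data.Maybe.Base using (Maybe; just; nothing)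
open import Data.Nat.Base using (ℕ; zero; suc; _<_)
open import Data.Nat.Induction using (Acc; acc; <-wellFounded)
open import Data.Product using (Σ; _×_; _,_; proj₁; proj₂; ∃-syntax)
open import Data.String using (String) renaming (_≟_ to _≟ˢ_)
open import Data.Sum using (_⊎_; inj₁; inj₂; [_,_]′)
open import Data.Unit.Base using (⊤; tt)
open import Function.Base using (_∘_; id)
open import Function.Bundles using (_⇔_; mk⇔; module Equivalence)
open import Level using (Level; 0ℓ)
open import Relation.Binary.Definitions using (DecidableEquality)
open import Relation.Binary.PropositionalEquality using (_≡_; refl; sym; trans; cong; subst)
open import Relation.Nullary using (¬_; Dec; yes; no; does; contradiction; _×-dec_; _→-dec_)
open import Relation.Nullary.Decidable using (map′)
open import Relation.Nullary.Reflects
  using (Reflects; ofʸ; ofⁿ; ⊥-reflects; ⊤-reflects; ¬-reflects; _×-reflects_; _⊎-reflects_; _→-reflects_)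
open import Relation.Unary using (Pred; _∈_; _⊆_; _∪_; ｛_｝; ∅; Decidable)

private variable
  u   : Level
  𝒮   : Pred Formula 0ℓ
  Γ Δ : Pred Formula 0ℓ
  p q : Formula

-- Derivations from hypotheses

infix 3 _∣_▷_

-- Necessitation applies to theorems only, which keeps the deduction theorem valid.
data _∣_▷_ (𝒮 Γ : Pred Formula 0ℓ) : Pred Formula 0ℓ where
  theorem : 𝒮 ⊢ p → 𝒮 ∣ Γ ▷ p
  assume  : p ∈ Γ → 𝒮 ∣ Γ ▷ p
  _·_     : 𝒮 ∣ Γ ▷ p ⊃ q → 𝒮 ∣ Γ ▷ p → 𝒮 ∣ Γ ▷ q

infixl 9 _·_

theorem⁻¹ : 𝒮 ∣ ∅ ▷ p → 𝒮 ⊢ p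
theorem⁻¹ (theorem d) = d
theorem⁻¹ (d · e)     = mp (theorem⁻¹ d) (theorem⁻¹ e)

weaken : Γ ⊆ Δ → 𝒮 ∣ Γ ▷ p → 𝒮 ∣ Δ ▷ p
weaken Γ⊆Δ (theorem d) = theorem d
weaken Γ⊆Δ (assume x)  = assume (Γ⊆Δ x)
weaken Γ⊆Δ (d · e)     = weaken Γ⊆Δ d · weaken Γ⊆Δ e

latest : 𝒮 ∣ Γ ∪ ｛ p ｝ ▷ p
latest = assume (inj₂ refl)

earlier : 𝒮 ∣ Γ ▷ q → 𝒮 ∣ Γ ∪ ｛ p ｝ ▷ q
earlier = weaken inj₁

deduction : 𝒮 ∣ Γ ∪ ｛ p ｝ ▷ q → 𝒮 ∣ Γ ▷ p ⊃ q
deduction (theorem d)            = theorem (ax-K _ _) · theorem d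
deduction (assume (inj₁ x))      = theorem (ax-K _ _) · assume x
deduction {p = p} (assume (inj₂ refl)) =
  theorem (ax-S p (p ⊃ p) p) · theorem (ax-K _ _) · theorem (ax-K _ _)
deduction (d · e)                = theorem (ax-S _ _ _) · deduction d · deduction e

-- Every node of the derivation is boxed in turn: theorems are necessitated, assumptions give way to
-- the proofs of their boxes, and `ax-□` recombines applications.
□-intro : (∀ {r} → r ∈ Δ → 𝒮 ∣ Γ ▷ □ r) → 𝒮 ∣ Δ ▷ q → 𝒮 ∣ Γ ▷ □ q
□-intro □Δ (theorem d) = theorem (nec d)
□-intro □Δ (assume x)  = □Δ x
□-intro □Δ (d · e)     = theorem (ax-□ _ _) · □-intro □Δ d · □-intro □Δ e

by-contradiction : 𝒮 ∣ Γ ∪ ｛ p ⊃ ⊥′ ｝ ▷ ⊥′ → 𝒮 ∣ Γ ▷ p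
by-contradiction d = theorem (ax-DN _) · deduction d

ex-falso : 𝒮 ∣ Γ ▷ ⊥′ → 𝒮 ∣ Γ ▷ p
ex-falso d = by-contradiction (earlier d)

↔-to : 𝒮 ⊢ p ↔ q → 𝒮 ∣ Γ ▷ p → 𝒮 ∣ Γ ▷ q
↔-to e d = theorem (mp (ax-↔ˡ _ _) e) · d

↔-from : 𝒮 ⊢ p ↔ q → 𝒮 ∣ Γ ▷ q → 𝒮 ∣ Γ ▷ p
↔-from e d = theorem (mp (ax-↔ʳ _ _) e) · d

∧-intro : 𝒮 ∣ Γ ▷ p → 𝒮 ∣ Γ ▷ q → 𝒮 ∣ Γ ▷ p ∧ q
∧-intro d e = ↔-from (ax-∧ _ _) (deduction (latest · earlier d · earlier e))

∧-elimˡ : 𝒮 ∣ Γ ▷ p ∧ q → 𝒮 ∣ Γ ▷ p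
∧-elimˡ d = by-contradiction
  (earlier (↔-to (ax-∧ _ _) d) · deduction (ex-falso (earlier latest · latest)))

∧-elimʳ : 𝒮 ∣ Γ ▷ p ∧ q → 𝒮 ∣ Γ ▷ q
∧-elimʳ d = by-contradiction (earlier (↔-to (ax-∧ _ _) d) · deduction (earlier latest))

-- Löb's axiom for q ∧ □ q.
𝒢ℒ-□□ : 𝒢ℒ ∣ Γ ▷ □ q → 𝒢ℒ ∣ Γ ▷ □ □ q
𝒢ℒ-□□ {q = q} d = □-intro (λ { refl → □c }) (∧-elimʳ latest′)
  where
  c′ = q ∧ □ q

  latest′ : 𝒢ℒ ∣ ｛ c′ ｝ ▷ c′
  latest′ = assume refl

  -- From `q` and `□ c′` follows `c′`, since `□ c′` yields `□ q`. Boxing this argument gives the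
  -- premise of Löb's axiom for `c′` at the cost of `□ q`, which is `d`.
  □c = theorem (hyp (ax-GL c′)) ·
    □-intro {Δ = ｛ q ｝} (λ { refl → d })
      (deduction (∧-intro (earlier (assume refl))
        (□-intro {Δ = ｛ c′ ｝} (λ { refl → latest }) (∧-elimˡ latest′))))

-- Subformulas

-- Proper subformulas are separated so that `here` and `there` tell a formula from its proper
-- subformulas whatever its main connective.
sub parts : Formula → List Formula
sub p = p ∷ parts p

parts ⊥′       = []
parts ⊤′       = []
parts (atom _) = []
parts (~ p)    = sub p
parts (p ∧ q)  = sub p ++ sub q
parts (p ∨ q)  = sub p ++ sub q
parts (p ⊃ q)  = sub p ++ sub q
parts (p ↔ q)  = sub p ++ sub q
parts (□ p)    = sub p

sub-⊆     : ∀ p → q ∈ˡ sub p → ∀ {r} → r ∈ˡ sub q → r ∈ˡ sub p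
sub-⊆-parts : ∀ p → q ∈ˡ parts p → ∀ {r} → r ∈ˡ sub q → r ∈ˡ parts p
sub-⊆-++  : ∀ p p′ → q ∈ˡ sub p ++ sub p′ → ∀ {r} → r ∈ˡ sub q → r ∈ˡ sub p ++ sub p′

sub-⊆ p (here refl) = id
sub-⊆ p (there m)   = there ∘ sub-⊆-parts p m

sub-⊆-parts (~ p)   m = sub-⊆ p m
sub-⊆-parts (p ∧ q) m = sub-⊆-++ p q m
sub-⊆-parts (p ∨ q) m = sub-⊆-++ p q m
sub-⊆-parts (p ⊃ q) m = sub-⊆-++ p q m
sub-⊆-parts (p ↔ q) m = sub-⊆-++ p q m
sub-⊆-parts (□ p)   m = sub-⊆ p m

sub-⊆-++ p p′ m n with ∈-++⁻ (sub p) m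
... | inj₁ m′ = ∈-++⁺ˡ (sub-⊆ p m′ n)
... | inj₂ m′ = ∈-++⁺ʳ (sub p) (sub-⊆ p′ m′ n)

-- Decidable equality of formulas

-- Splitting equality into a partial test and its reflexivity avoids
-- one clause for each pair of distinct connectives.
match : (p q : Formula) → Maybe (p ≡ q)
match ⊥′ ⊥′ = just refl
match ⊤′ ⊤′ = just refl
match (atom a) (atom b) with a ≟ˢ b
... | yes refl = just refl
... | no  _    = nothing
match (~ p) (~ q) with match p q
... | just refl = just refl
... | nothing   = nothing
match (p ∧ q) (p′ ∧ q′) with match p p′ | match q q′
... | just refl | just refl = just refl
... | _         | _         = nothing
match (p ∨ q) (p′ ∨ q′) with match p p′ | match q q′
... | just refl | just refl = just refl
... | _         | _         = nothing
match (p ⊃ q) (p′ ⊃ q′) with match p p′ | match q q′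
... | just refl | just refl = just refl
... | _         | _         = nothing
match (p ↔ q) (p′ ↔ q′) with match p p′ | match q q′
... | just refl | just refl = just refl
... | _         | _         = nothing
match (□ p) (□ q) with match p q
... | just refl = just refl
... | nothing   = nothing
match _ _ = nothing

match-refl : ∀ p → ¬ match p p ≡ nothing
match-refl (atom a) e with a ≟ˢ a
match-refl (atom a) () | yes refl
match-refl (atom a) e  | no a≢a = a≢a refl
match-refl (~ p) e with match p p in eq
match-refl (~ p) () | just refl
match-refl (~ p) e  | nothing = match-refl p eq
match-refl (p ∧ q) e with match p p in eq | match q q in eq′
match-refl (p ∧ q) () | just refl | just refl
match-refl (p ∧ q) e  | nothing   | _       = match-refl p eq
match-refl (p ∧ q) e  | just _    | nothing = match-refl q eq′
match-refl (p ∨ q) e with match p p in eq | match q q in eq′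
match-refl (p ∨ q) () | just refl | just refl
match-refl (p ∨ q) e  | nothing   | _       = match-refl p eq
match-refl (p ∨ q) e  | just _    | nothing = match-refl q eq′
match-refl (p ⊃ q) e with match p p in eq | match q q in eq′
match-refl (p ⊃ q) () | just refl | just refl
match-refl (p ⊃ q) e  | nothing   | _       = match-refl p eq
match-refl (p ⊃ q) e  | just _    | nothing = match-refl q eq′
match-refl (p ↔ q) e with match p p in eq | match q q in eq′
match-refl (p ↔ q) () | just refl | just refl
match-refl (p ↔ q) e  | nothing   | _       = match-refl p eq
match-refl (p ↔ q) e  | just _    | nothing = match-refl q eq′
match-refl (□ p) e with match p p in eq
match-refl (□ p) () | just refl
match-refl (□ p) e  | nothing = match-refl p eq

_≟_ : DecidableEquality Formula
p ≟ q with match p q in eq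
... | just p≡q = yes p≡q
... | nothing  = no λ { refl → match-refl p eq }

-- States

State : Set
State = Formula → Bool

-- Boxed formulas count as propositional variables here; elimination is what later ties their values
-- to the accessible states.
eval : State → Formula → Bool
eval s ⊥′         = false
eval s ⊤′         = true
eval s (atom a)   = s (atom a)
eval s (~ p)      = not (eval s p)
eval s (p ∧ q)    = eval s p && eval s q
eval s (p ∨ q)    = eval s p || eval s q
eval s (p ⊃ q)    = not (eval s p) || eval s q
eval s (p ↔ q)    = (not (eval s p) || eval s q) && (not (eval s q) || eval s p)
eval s (□ p)      = s (□ p)

_[_≔_] : State → Formula → Bool → State
(s [ k ≔ b ]) q = if does (q ≟ k) then b else s q

assignments : List Formula → List State
assignments []       = (λ _ → false) ∷ []
assignments (k ∷ ks) = map (λ s → s [ k ≔ true ]) (assignments ks) ++ map (λ s → s [ k ≔ false ]) (assignments ks)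

-- The negative literal is `p ⊃ ⊥′` rather than `~ p`, so that the deduction theorem introduces it
-- and `_·_` eliminates it without further axioms.
literal : Formula → Bool → Formula
literal p b = if b then p else p ⊃ ⊥′

literal-true : ∀ {b} → 𝒮 ∣ Γ ▷ literal p b → b ≡ true → 𝒮 ∣ Γ ▷ p
literal-true d refl = d

literal-false : ∀ {b} → 𝒮 ∣ Γ ▷ literal p b → b ≡ false → 𝒮 ∣ Γ ▷ p ⊃ ⊥′
literal-false d refl = d

Decides : Pred Formula 0ℓ → Pred Formula 0ℓ → List Formula → State → Set
Decides 𝒮 Γ ks s = ∀ {k} → k ∈ˡ ks → 𝒮 ∣ Γ ▷ literal k (s k)

-- Keys may repeat. Equality with `k` is therefore tested before the position in the list: if `k`
-- recurs in `ks`, its overriding value is the one to be decided.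
decides-∷ : ∀ {k ks s} b → 𝒮 ∣ Γ ▷ literal k b → Decides 𝒮 Γ ks s → Decides 𝒮 Γ (k ∷ ks) (s [ k ≔ b ])
decides-∷ {k = k} b d D {k′} m with k′ ≟ k
decides-∷ b d D m           | yes refl = d
decides-∷ b d D (here refl) | no k≢k   = contradiction refl k≢k
decides-∷ b d D (there m)   | no _     = D m

-- If `q` fails, the first case refutes `p`, and the second case then proves `q`.
case-split : 𝒮 ∣ Γ ∪ ｛ p ｝ ▷ q → 𝒮 ∣ Γ ∪ ｛ p ⊃ ⊥′ ｝ ▷ q → 𝒮 ∣ Γ ▷ q
case-split d e = by-contradiction
  (latest · (earlier (deduction e) · deduction (earlier latest · (earlier (earlier (deduction d)) · latest))))

-- Each split on a key adds a literal to the context, so the argument for a single state has to work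
-- in every `Δ` extending `Γ` for the induction to go through.
split-states : ∀ ks →
  (∀ {s} → s ∈ˡ assignments ks → ∀ {Δ} → Γ ⊆ Δ → Decides 𝒮 Δ ks s → 𝒮 ∣ Δ ▷ q) →
  𝒮 ∣ Γ ▷ q
split-states []       h = h (here refl) id λ ()
split-states (k ∷ ks) h = split-states ks λ {s} m Γ⊆Δ D →
  case-split
    (h (∈-++⁺ˡ (∈-map⁺ _ m)) (inj₁ ∘ Γ⊆Δ) (decides-∷ {s = s} true latest (earlier ∘ D)))
    (h (∈-++⁺ʳ _ (∈-map⁺ _ m)) (inj₁ ∘ Γ⊆Δ) (decides-∷ {s = s} false latest (earlier ∘ D)))

-- Literals of compound formulas

literal-↔ : ∀ b → 𝒮 ⊢ p ↔ q → 𝒮 ∣ Γ ▷ literal q b → 𝒮 ∣ Γ ▷ literal p b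
literal-↔ true  e d = ↔-from e d
literal-↔ false e d = deduction (earlier d · ↔-to e latest)

literal-⊥ : 𝒮 ∣ Γ ▷ literal ⊥′ false
literal-⊥ = deduction latest

literal-⊃ : ∀ a b → 𝒮 ∣ Γ ▷ literal p a → 𝒮 ∣ Γ ▷ literal q b → 𝒮 ∣ Γ ▷ literal (p ⊃ q) (not a || b)
literal-⊃ false b     d e = deduction (ex-falso (earlier d · latest))
literal-⊃ true  true  d e = deduction (earlier e)
literal-⊃ true  false d e = deduction (earlier e · (latest · earlier d))

literal-~ : ∀ a → 𝒮 ∣ Γ ▷ literal p a → 𝒮 ∣ Γ ▷ literal (~ p) (not a)
literal-~ a d = literal-↔ (not a) (ax-~ _)
  (subst (λ b → _ ∣ _ ▷ literal (_ ⊃ ⊥′) b) (Bool.∨-identityʳ (not a)) (literal-⊃ a false d literal-⊥))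

literal-∧ : ∀ a b → 𝒮 ∣ Γ ▷ literal p a → 𝒮 ∣ Γ ▷ literal q b → 𝒮 ∣ Γ ▷ literal (p ∧ q) (a && b)
literal-∧ true  true  d e = ∧-intro d e
literal-∧ true  false d e = deduction (earlier e · ∧-elimʳ latest)
literal-∧ false b     d e = deduction (earlier d · ∧-elimˡ latest)

literal-∨ : ∀ a b → 𝒮 ∣ Γ ▷ literal p a → 𝒮 ∣ Γ ▷ literal q b → 𝒮 ∣ Γ ▷ literal (p ∨ q) (a || b)
literal-∨ a b d e = literal-↔ (a || b) (ax-∨ _ _)
  (subst (λ x → _ ∣ _ ▷ literal (~ (~ _ ∧ ~ _)) x) (deMorgan a b)
    (literal-~ (not a && not b) (literal-∧ (not a) (not b) (literal-~ a d) (literal-~ b e))))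
  where
  deMorgan : ∀ a b → not (not a && not b) ≡ a || b
  deMorgan true  b     = refl
  deMorgan false true  = refl
  deMorgan false false = refl

-- The axioms give the two halves of a biconditional only as implications; this step connects them
-- with the conjunction that `eval` computes.
literal-∧-↔ : ∀ b → 𝒮 ∣ Γ ▷ literal ((p ⊃ q) ∧ (q ⊃ p)) b → 𝒮 ∣ Γ ▷ literal (p ↔ q) b
literal-∧-↔ true  d = theorem (ax-↔ _ _) · ∧-elimˡ d · ∧-elimʳ d
literal-∧-↔ false d = deduction (earlier d ·
  ∧-intro (theorem (ax-↔ˡ _ _) · latest) (theorem (ax-↔ʳ _ _) · latest))

-- Elimination

module _ {X : Set} (xs₀ : List X) (OK : List X → X → Set) (OK? : ∀ ys → Decidable (OK ys))
         (Refuted : X → Set₁) where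

  Covers : List X → Set₁
  Covers ys = ∀ {x} → x ∈ˡ xs₀ → x ∈ˡ ys ⊎ Refuted x

  -- Each round discards all members that fail `OK` relative to the current list, so the list
  -- shrinks strictly until all pass. `OK` depends on the list and must be tested afresh each round,
  -- whereas a refutation does not and stays valid; hence `Covers` is an invariant, and it is
  -- available when the next member is refuted.
  eliminate : (∀ {ys x} → Covers ys → ¬ OK ys x → Refuted x) → Σ (List X) λ ys → All (OK ys) ys × Covers ys
  eliminate refute = go xs₀ inj₁ (<-wellFounded _)
    where
    go : ∀ ys → Covers ys → Acc _<_ (length ys) → Σ (List X) λ zs → All (OK zs) zs × Covers zs
    go ys cov (acc rec) with All.all? (OK? ys) ys
    ... | yes ok = ys , ok , cov
    ... | no ¬ok = go (filter (OK? ys) ys) cov′ (rec (filter-notAll (OK? ys) ys (¬All⇒Any¬ (OK? ys) ys ¬ok)))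
      where
      cov′ : Covers (filter (OK? ys) ys)
      cov′ {x} m with cov m | OK? ys x
      ... | inj₂ ref | _       = inj₂ ref
      ... | inj₁ m′  | yes okx = inj₁ (∈-filter⁺ (OK? ys) m′ okx)
      ... | inj₁ _   | no ¬okx = inj₂ (refute cov ¬okx)

all-or : ∀ {a} {A X : Set} {P : Pred X a} (xs : List X) → (∀ {x} → x ∈ˡ xs → P x ⊎ A) → All P xs ⊎ A
all-or []       h = inj₁ []
all-or (x ∷ xs) h with h (here refl) | all-or xs (h ∘ there)
... | inj₁ px | inj₁ pxs = inj₁ (px ∷ pxs)
... | inj₂ a  | _        = inj₂ a
... | inj₁ _  | inj₂ a   = inj₂ a

bool-cases : ∀ b → b ≡ true ⊎ b ≡ false
bool-cases true  = inj₁ refl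
bool-cases false = inj₂ refl

-- The canonical model over the subformulas of a formula

module Canonical (p₀ : Formula) where

  B keys : List Formula
  B = sub p₀

  -- Boxing every member of B, rather than selecting the boxed members,
  -- makes every formula of B a possible argument of □ in what follows.
  keys = B ++ map □_ B

  □∈keys : q ∈ˡ B → □ q ∈ˡ keys
  □∈keys m = ∈-++⁺ʳ B (∈-map⁺ □_ m)

  _WithinB : Formula → Set
  q WithinB = ∀ {r} → r ∈ˡ sub q → r ∈ˡ B

  ∈⇒within : q ∈ˡ B → q WithinB
  ∈⇒within = sub-⊆ p₀

  withinˡ : ∀ p q → (∀ {r} → r ∈ˡ sub p ++ sub q → r ∈ˡ B) → p WithinB
  withinˡ p q ⊆B = ⊆B ∘ ∈-++⁺ˡ

  withinʳ : ∀ p q → (∀ {r} → r ∈ˡ sub p ++ sub q → r ∈ˡ B) → q WithinB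
  withinʳ p q ⊆B = ⊆B ∘ ∈-++⁺ʳ (sub p)

  -- Kalmár's lemma.
  decide-literal : ∀ s → Decides 𝒮 Γ keys s → ∀ q → q WithinB → 𝒮 ∣ Γ ▷ literal q (eval s q)
  decide-literal {𝒮} {Γ} s D = go
    where
    go : ∀ q → q WithinB → 𝒮 ∣ Γ ▷ literal q (eval s q)
    go₂ : ∀ p q → (∀ {r} → r ∈ˡ sub p ++ sub q → r ∈ˡ B) →
          (𝒮 ∣ Γ ▷ literal p (eval s p)) × (𝒮 ∣ Γ ▷ literal q (eval s q))
    go₂ p q ⊆B = go p (withinˡ p q ⊆B) , go q (withinʳ p q ⊆B)
    go ⊥′       ⊆B = literal-⊥
    go ⊤′       ⊆B = literal-↔ true ax-⊤ literal-⊥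
    go (atom a) ⊆B = D (∈-++⁺ˡ (⊆B (here refl)))
    go (~ p)    ⊆B = literal-~ _ (go p (⊆B ∘ there))
    go (p ∧ q)  ⊆B with d , e ← go₂ p q (⊆B ∘ there) = literal-∧ _ _ d e
    go (p ∨ q)  ⊆B with d , e ← go₂ p q (⊆B ∘ there) = literal-∨ _ _ d e
    go (p ⊃ q)  ⊆B with d , e ← go₂ p q (⊆B ∘ there) = literal-⊃ _ _ d e
    go (p ↔ q)  ⊆B with d , e ← go₂ p q (⊆B ∘ there) =
      literal-∧-↔ _
        (literal-∧ (not (eval s p) || eval s q) (not (eval s q) || eval s p)
          (literal-⊃ (eval s p) (eval s q) d e) (literal-⊃ (eval s q) (eval s p) e d))
    go (□ p)    ⊆B = D (∈-++⁺ˡ (⊆B (here refl)))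

  decide-member : ∀ s → Decides 𝒮 Γ keys s → q ∈ˡ B → 𝒮 ∣ Γ ▷ literal q (eval s q)
  decide-member s D m = decide-literal s D _ (∈⇒within m)

  -- The context is arbitrary so that a refutation can be used inside whatever context
  -- `split-states` has accumulated.
  Refutable : Pred Formula 0ℓ → State → Set₁
  Refutable 𝒮 s = ∀ {Γ} → Decides 𝒮 Γ keys s → 𝒮 ∣ Γ ▷ ⊥′

  -- This collects what is specific to a logic. `Admissible` constrains a single state, as
  -- reflexivity requires; `seed-□` is the logic's way of proving a box; `seed-⟶` says that a state
  -- that is not accessible is inconsistent with the seed.
  record Accessibility (𝒮 : Pred Formula 0ℓ) : Set₁ where
    infix 4 _⟶_
    field
      _⟶_          : State → State → Set
      _⟶?_         : ∀ s t → Dec (s ⟶ t)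
      Admissible   : State → Set
      Admissible?  : Decidable Admissible
      transmits    : ∀ s t {q} → s ⟶ t → q ∈ˡ B → s (□ q) ≡ true → eval t q ≡ true
      inadmissible : ∀ s → ¬ Admissible s → Refutable 𝒮 s
      -- Formulas whose truth at a state makes it a witness for the falsity of □ q at s, once it falsifies q.
      Seed         : State → Formula → Pred Formula 0ℓ
      seed-□       : ∀ s {Γ q} → Decides 𝒮 Γ keys s → 𝒮 ∣ Seed s q ▷ q → 𝒮 ∣ Γ ▷ □ q
      seed-⟶       : ∀ s t {Γ q} → q ∈ˡ B → s (□ q) ≡ false → Decides 𝒮 Γ keys t →
                     Seed s q ⊆ Γ → s ⟶ t ⊎ (𝒮 ∣ Γ ▷ ⊥′)

    FalsifiedFrom : List State → State → Formula → Set
    FalsifiedFrom G s q = s (□ q) ≡ false → Any (λ t → s ⟶ t × eval t q ≡ false) G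

    OK : List State → State → Set
    OK G s = Admissible s × All (FalsifiedFrom G s) B

    FalsifiedFrom? : ∀ G s → Decidable (FalsifiedFrom G s)
    FalsifiedFrom? G s q =
      (s (□ q) Bool.≟ false) →-dec Any.any? (λ t → (s ⟶? t) ×-dec (eval t q Bool.≟ false)) G

    OK? : ∀ G → Decidable (OK G)
    OK? G s = Admissible? s ×-dec All.all? (FalsifiedFrom? G s) B

    -- The state asserts that `□ q` is false, yet `□ q` is provable from it: by `seed-□` it suffices
    -- to derive `q` from the seed, by cases over all states `t`. Either `t` makes `q` true, or it
    -- contradicts the seed, or it is an accessible state falsifying `q` and is refuted by
    -- assumption.
    no-successor : ∀ s {q} → q ∈ˡ B → s (□ q) ≡ false →
      (∀ {t} → t ∈ˡ assignments keys → s ⟶ t → eval t q ≡ false → Refutable 𝒮 t) → Refutable 𝒮 s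
    no-successor s {q} q∈B s□q refuted D =
      literal-false (D (□∈keys q∈B)) s□q · seed-□ s D (split-states keys refute)
      where
      refute : ∀ {t} → t ∈ˡ assignments keys → ∀ {Δ} → Seed s q ⊆ Δ → Decides 𝒮 Δ keys t → 𝒮 ∣ Δ ▷ q
      refute {t} t∈ {Δ} Seed⊆Δ E = by-cases (bool-cases (eval t q)) (seed-⟶ s t q∈B s□q E Seed⊆Δ)
        where
        by-cases : eval t q ≡ true ⊎ eval t q ≡ false → s ⟶ t ⊎ (𝒮 ∣ Δ ▷ ⊥′) → 𝒮 ∣ Δ ▷ q
        by-cases (inj₁ tq) _          = literal-true (decide-member t E q∈B) tq
        by-cases (inj₂ tq) (inj₂ d)   = ex-falso d
        by-cases (inj₂ tq) (inj₁ s⟶t) = ex-falso (refuted t∈ s⟶t tq E)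

    -- An admissible bad state has a false `□ q` without a witness in `G`. By `Covers`, every
    -- accessible state that falsifies `q` has then been refuted already, so `no-successor` applies.
    refute-bad : ∀ {G s} → Covers (assignments keys) OK OK? (Refutable 𝒮) G → ¬ OK G s → Refutable 𝒮 s
    refute-bad {G} {s} cov ¬ok with Admissible? s
    ... | no ¬adm = inadmissible s ¬adm
    ... | yes adm with find (¬All⇒Any¬ (FalsifiedFrom? G s) B (λ f → ¬ok (adm , f)))
    ...   | q , q∈B , ¬f with bool-cases (s (□ q))
    ...     | inj₁ s□q = contradiction (λ s□q′ → contradiction (trans (sym s□q) s□q′) λ ()) ¬f
    ...     | inj₂ s□q = no-successor s q∈B s□q λ t∈ s⟶t tq →
                [ (λ t∈G → contradiction (λ _ → lose t∈G (s⟶t , tq)) ¬f) , id ]′ (cov t∈)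

    prove-or-refute : 𝒮 ⊢ p₀ ⊎ Σ (List State) λ G → All (OK G) G × Any (λ s → eval s p₀ ≡ false) G
    prove-or-refute with eliminate (assignments keys) OK OK? (Refutable 𝒮) refute-bad
    ... | G , ok , cov with Any.any? (λ s → eval s p₀ Bool.≟ false) G
    ...   | yes bad = inj₂ (G , ok , bad)
    ...   | no ¬bad = inj₁ (theorem⁻¹ (split-states keys prove))
      where
      prove : ∀ {s} → s ∈ˡ assignments keys → ∀ {Δ} → ∅ ⊆ Δ → Decides 𝒮 Δ keys s → 𝒮 ∣ Δ ▷ p₀
      prove {s} s∈ _ D with bool-cases (eval s p₀) | cov s∈
      ... | inj₁ sp | _        = literal-true (decide-member s D (here refl)) sp
      ... | inj₂ sp | inj₁ s∈G = contradiction (lose s∈G sp) ¬bad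
      ... | inj₂ sp | inj₂ ref = ex-falso (ref D)

-- Countermodels inside U

Embedding : ℕ → Set u → Set u
Embedding n U = Σ (Fin n → U) λ f → ∀ {i j} → f i ≡ f j → i ≡ j

-- The image of an embedding of `Fin n` cannot exhaust `U`. A point outside it, available only under
-- double negation, becomes the value at `zero` of the next embedding.
infinite⇒embedding : {U : Set u} → Infinite U → ∀ n → ¬ ¬ Embedding n U
infinite⇒embedding inf zero    k = k ((λ ()) , λ { {()} })
infinite⇒embedding {U = U} inf (suc n) k = infinite⇒embedding inf n λ (f , inj) →
  inf (tabulate f , λ x x∉ → k (extend f x , extend-injective f inj x∉))
  where
  extend : (Fin n → U) → U → Fin (suc n) → U
  extend f x zero    = x
  extend f x (suc i) = f i

  extend-injective : ∀ f → (∀ {i j} → f i ≡ f j → i ≡ j) → ∀ {x} → ¬ x ∈ˡ tabulate f →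
                     ∀ {i j} → extend f x i ≡ extend f x j → i ≡ j
  extend-injective f inj x∉ {zero}  {zero}  e = refl
  extend-injective f inj x∉ {zero}  {suc j} refl = contradiction (∈-tabulate⁺ j) x∉
  extend-injective f inj x∉ {suc i} {zero}  refl = contradiction (∈-tabulate⁺ i) x∉
  extend-injective f inj x∉ {suc i} {suc j} e = cong suc (inj e)

-- Boolean reflection

map-reflects : ∀ {a b} {A : Set a} {B : Set b} {x} → (A → B) → (B → A) → Reflects A x → Reflects B x
map-reflects f g (ofʸ a)  = ofʸ (f a)
map-reflects f g (ofⁿ ¬a) = ofⁿ (¬a ∘ g)

⇔-reflects : ∀ {a b} {A : Set a} {B : Set b} {x y} → Reflects A x → Reflects B y →
             Reflects (A ⇔ B) ((not x || y) && (not y || x))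
⇔-reflects ra rb =
  map-reflects (λ (f , g) → mk⇔ f g) (λ e → Equivalence.to e , Equivalence.from e)
    ((ra →-reflects rb) ×-reflects (rb →-reflects ra))

reflects-true : ∀ {a} {A : Set a} {b} → Reflects A b → b ≡ true → A
reflects-true (ofʸ a) _ = a

reflects-false : ∀ {a} {A : Set a} {b} → Reflects A b → b ≡ false → ¬ A
reflects-false (ofⁿ ¬a) _ = ¬a

-- Worlds stand for indices rather than for states, so injectivity concerns `f` alone and equal
-- states at different indices do no harm.
module Image {U : Set u} {n : ℕ} (f : Fin n → U) (inj : ∀ {i j} → f i ≡ f j → i ≡ j) (i₀ : Fin n)
             (st : Fin n → State) (_⟶_ : State → State → Set) (_⟶?_ : ∀ s t → Dec (s ⟶ t)) where

  Related : U → U → Set u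
  Related w w′ = ∃[ i ] ∃[ j ] (w ≡ f i × w′ ≡ f j × st i ⟶ st j)

  related⁻ : ∀ {i j} → Related (f i) (f j) → st i ⟶ st j
  related⁻ (i , j , e , e′ , r) with refl ← inj e | refl ← inj e′ = r

  related⁺ : ∀ {i j} → st i ⟶ st j → Related (f i) (f j)
  related⁺ r = _ , _ , refl , refl , r

  frame : Frame U
  frame = record
    { W        = λ w → ∃[ i ] w ≡ f i
    ; R        = Related
    ; nonempty = f i₀ , i₀ , refl
    ; R⊆W×W    = λ (i , j , e , e′ , _) → (i , e) , (j , e′)
    ; R?       = λ { (i , refl) (j , refl) → map′ related⁺ related⁻ (st i ⟶? st j) }
    }

  finite : IsFinite frame
  finite = tabulate f , λ w → mk⇔ (λ { (i , refl) → ∈-tabulate⁺ i }) ∈-tabulate⁻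

  reflexive : (∀ i → st i ⟶ st i) → IsReflexive frame
  reflexive ⟶-refl (i , refl) = related⁺ (⟶-refl i)

  transitive : (∀ s t v → s ⟶ t → t ⟶ v → s ⟶ v) → IsTransitive frame
  transitive ⟶-trans (i , j , refl , refl , r) (j′ , k , e , refl , r′) with refl ← inj e =
    related⁺ (⟶-trans _ _ _ r r′)

  irreflexive : (∀ s → ¬ s ⟶ s) → IsIrreflexive frame
  irreflexive ⟶-irrefl refl (i , j , refl , e , r) with refl ← inj e = ⟶-irrefl _ r

  TrueAt : String → U → Set u
  TrueAt a w = ∃[ i ] (w ≡ f i × st i (atom a) ≡ true)

  trueAt⁻ : ∀ {a i} → TrueAt a (f i) → st i (atom a) ≡ true
  trueAt⁻ (j , e , t) with refl ← inj e = t

  valuation : Valuation frame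
  valuation = record
    { V  = TrueAt
    ; V? = λ { a (i , refl) → map′ (λ t → i , refl , t) trueAt⁻ (st i (atom a) Bool.≟ true) }
    }

  module Truth (p₀ : Formula)
    (transmits : ∀ s t {q} → s ⟶ t → q ∈ˡ sub p₀ → s (□ q) ≡ true → eval t q ≡ true)
    (falsified : ∀ i {q} → q ∈ˡ sub p₀ → st i (□ q) ≡ false → ∃[ j ] (st i ⟶ st j × eval (st j) q ≡ false))
    where

    open Canonical p₀

    -- The truth lemma. `Reflects` carries both directions through one induction; at a box,
    -- `transmits` settles the value `true` and `falsified` supplies the refuting world for `false`.
    truth : ∀ q → q WithinB → ∀ i → Reflects (_⊩_ valuation (f i) q) (eval (st i) q)
    truth ⊥′       ⊆B i = ⊥-reflects
    truth ⊤′       ⊆B i = ⊤-reflects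
    truth (atom a) ⊆B i with st i (atom a) in eq
    ... | true  = ofʸ (i , refl , eq)
    ... | false = ofⁿ λ t → contradiction (trans (sym eq) (trueAt⁻ t)) λ ()
    truth (~ p)    ⊆B i = ¬-reflects (truth p (⊆B ∘ there) i)
    truth (p ∧ q)  ⊆B i = truth p (withinˡ p q (⊆B ∘ there)) i ×-reflects truth q (withinʳ p q (⊆B ∘ there)) i
    truth (p ∨ q)  ⊆B i = truth p (withinˡ p q (⊆B ∘ there)) i ⊎-reflects truth q (withinʳ p q (⊆B ∘ there)) i
    truth (p ⊃ q)  ⊆B i = truth p (withinˡ p q (⊆B ∘ there)) i →-reflects truth q (withinʳ p q (⊆B ∘ there)) i
    truth (p ↔ q)  ⊆B i = ⇔-reflects (truth p (withinˡ p q (⊆B ∘ there)) i) (truth q (withinʳ p q (⊆B ∘ there)) i)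
    truth (□ p)    ⊆B i with st i (□ p) in eq
    ... | true  = ofʸ λ { (j , refl) r →
            reflects-true (truth p (⊆B ∘ there) j) (transmits (st i) (st j) (related⁻ r) (⊆B (there (here refl))) eq) }
    ... | false with falsified i (⊆B (there (here refl))) eq
    ...   | j , r , e = ofⁿ λ □p → reflects-false (truth p (⊆B ∘ there) j) e (□p (j , refl) (related⁺ r))

-- Completeness from an accessibility relation

module _ {U : Set u} (inf : Infinite U) (p : Formula) {𝒮 : Pred Formula 0ℓ}
         (A : Canonical.Accessibility p 𝒮) where

  open Canonical p
  open Accessibility A

  -- Validity is assumed only on frames built from admissible states, so each logic has merely to
  -- check that such frames belong to its class.
  complete :
    (∀ {n} (f : Fin n → U) (inj : ∀ {i j} → f i ≡ f j → i ≡ j) i₀ st → (∀ i → Admissible (st i)) →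
      Image.frame f inj i₀ st _⟶_ _⟶?_ ⊨ p) →
    𝒮 ⊢ p
  complete valid with prove-or-refute
  ... | inj₁ d = d
  -- This branch is to be shown absurd, so the doubly negated embedding may be used as if it were
  -- given.
  ... | inj₂ (G , ok , bad) = ⊥-elim (infinite⇒embedding inf (length G) λ (f , inj) →
      let open Image f inj i₀ (lookup G) _⟶_ _⟶?_
          open Truth p transmits falsified
      in  reflects-false (truth p id i₀) (lookup-index bad)
            (valid f inj i₀ (lookup G) (λ i → proj₁ (ok-at i)) valuation (i₀ , refl)))
    where
    i₀ = Any.index bad

    ok-at : ∀ i → OK G (lookup G i)
    ok-at i = All.lookup ok (∈-lookup i)

    falsified : ∀ i {q} → q ∈ˡ B → lookup G i (□ q) ≡ false →
                ∃[ j ] (lookup G i ⟶ lookup G j × eval (lookup G j) q ≡ false)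
    falsified i q∈B e with a ← All.lookup (proj₂ (ok-at i)) q∈B e = Any.index a , lookup-index a

-- The accessibility relations of the four logics

module Logics (p₀ : Formula) where

  open Canonical p₀

  Transmits Persists Gains : State → State → Set
  Transmits s t = All (λ q → s (□ q) ≡ true → eval t q ≡ true) B
  Persists  s t = All (λ q → s (□ q) ≡ true → t (□ q) ≡ true) B
  Gains     s t = Any (λ q → s (□ q) ≡ false × t (□ q) ≡ true) B

  Transmits? : ∀ s t → Dec (Transmits s t)
  Transmits? s t = All.all? (λ q → (s (□ q) Bool.≟ true) →-dec (eval t q Bool.≟ true)) B

  Persists? : ∀ s t → Dec (Persists s t)
  Persists? s t = All.all? (λ q → (s (□ q) Bool.≟ true) →-dec (t (□ q) Bool.≟ true)) B

  Gains? : ∀ s t → Dec (Gains s t)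
  Gains? s t = Any.any? (λ q → (s (□ q) Bool.≟ false) ×-dec (t (□ q) Bool.≟ true)) B

  -- At a disagreement the context both proves and refutes `φ q`. Taking the identity or `□_` for
  -- `φ` covers `Transmits` and `Persists` alike, as `eval t (□ q)` computes to `t (□ q)`.
  agrees-or-⊥ : ∀ (s t : State) (φ : Formula → Formula) →
    (∀ {q} → q ∈ˡ B → 𝒮 ∣ Γ ▷ literal (φ q) (eval t (φ q))) →
    (∀ {q} → q ∈ˡ B → s (□ q) ≡ true → 𝒮 ∣ Γ ▷ φ q) →
    All (λ q → s (□ q) ≡ true → eval t (φ q) ≡ true) B ⊎ (𝒮 ∣ Γ ▷ ⊥′)
  agrees-or-⊥ {𝒮} {Γ} s t φ decided forced =
    all-or B λ {q} q∈B → agrees q∈B (bool-cases (s (□ q))) (bool-cases (eval t (φ q)))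
    where
    agrees : ∀ {q} → q ∈ˡ B → s (□ q) ≡ true ⊎ s (□ q) ≡ false →
             eval t (φ q) ≡ true ⊎ eval t (φ q) ≡ false →
             (s (□ q) ≡ true → eval t (φ q) ≡ true) ⊎ (𝒮 ∣ Γ ▷ ⊥′)
    agrees q∈B _          (inj₁ tφ) = inj₁ λ _ → tφ
    agrees q∈B (inj₁ s□q) (inj₂ tφ) = inj₂ (literal-false (decided q∈B) tφ · forced q∈B s□q)
    agrees q∈B (inj₂ s□q) (inj₂ tφ) = inj₁ λ s□q′ → contradiction (trans (sym s□q) s□q′) λ ()

  transmits-or-⊥ : ∀ s t → Decides 𝒮 Γ keys t →
    (∀ {q} → q ∈ˡ B → s (□ q) ≡ true → 𝒮 ∣ Γ ▷ q) → Transmits s t ⊎ (𝒮 ∣ Γ ▷ ⊥′)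
  transmits-or-⊥ s t D = agrees-or-⊥ s t id (decide-member t D)

  persists-or-⊥ : ∀ s t → Decides 𝒮 Γ keys t →
    (∀ {q} → q ∈ˡ B → s (□ q) ≡ true → 𝒮 ∣ Γ ▷ □ q) → Persists s t ⊎ (𝒮 ∣ Γ ▷ ⊥′)
  persists-or-⊥ s t D = agrees-or-⊥ s t □_ (λ m → D (□∈keys m))

  Unboxed Boxed : State → Pred Formula 0ℓ
  Unboxed s q = q ∈ˡ B × s (□ q) ≡ true
  Boxed   s q = ∃[ r ] (q ≡ □ r × r ∈ˡ B × s (□ r) ≡ true)

  accessK : Accessibility 𝒮
  accessK = record
    { _⟶_          = Transmits
    ; _⟶?_         = Transmits?
    ; Admissible   = λ _ → ⊤
    ; Admissible?  = λ _ → yes tt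
    ; transmits    = λ _ _ a → All.lookup a
    ; inadmissible = λ _ ¬a → contradiction tt ¬a
    ; Seed         = λ s _ → Unboxed s
    ; seed-□       = λ _ D → □-intro λ (m , e) → literal-true (D (□∈keys m)) e
    ; seed-⟶       = λ s t _ _ D ⊆Γ → transmits-or-⊥ s t D λ m e → assume (⊆Γ (m , e))
    }

  -- Reflexivity is imposed through `Admissible`: a state that fails to transmit to itself
  -- contradicts an instance of `ax-T`.
  accessT : Accessibility 𝒯
  accessT = record (accessK {𝒯})
    { Admissible   = λ s → Transmits s s
    ; Admissible?  = λ s → Transmits? s s
    ; inadmissible = λ s ¬a D →
        [ (λ a → contradiction a ¬a) , id ]′
          (transmits-or-⊥ s s D λ m e → theorem (hyp (ax-T _)) · literal-true (D (□∈keys m)) e)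
    }

  Transmits⁺ : State → State → Set
  Transmits⁺ s t = Transmits s t × Persists s t

  -- A box true at `s` persists to `t`; from there its body is transmitted to `v` and the box
  -- persists once more.
  Transmits⁺-trans : ∀ s t v → Transmits⁺ s t → Transmits⁺ t v → Transmits⁺ s v
  Transmits⁺-trans _ _ _ (_ , per) (tra′ , per′) =
    All.zipWith (λ (f , g) → g ∘ f) (per , tra′) , All.zipWith (λ (f , g) → g ∘ f) (per , per′)

  Seed⁺ : State → Pred Formula 0ℓ
  Seed⁺ s = Unboxed s ∪ Boxed s

  -- The passage from `□ q` to `□ □ q` is a parameter, since it is an axiom of `𝒦4` but a derived
  -- rule of `𝒢ℒ`.
  seed⁺-□ : ∀ s → (∀ {q} → 𝒮 ∣ Γ ▷ □ q → 𝒮 ∣ Γ ▷ □ □ q) → Decides 𝒮 Γ keys s →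
            ∀ {q} → q ∈ Seed⁺ s → 𝒮 ∣ Γ ▷ □ q
  seed⁺-□ s four D (inj₁ (m , e))            = literal-true (D (□∈keys m)) e
  seed⁺-□ s four D (inj₂ (r , refl , m , e)) = four (literal-true (D (□∈keys m)) e)

  seed⁺-⟶ : ∀ s t → Decides 𝒮 Γ keys t → Seed⁺ s ⊆ Γ → Transmits⁺ s t ⊎ (𝒮 ∣ Γ ▷ ⊥′)
  seed⁺-⟶ s t D ⊆Γ with transmits-or-⊥ s t D (λ m e → assume (⊆Γ (inj₁ (m , e))))
                      | persists-or-⊥ s t D (λ m e → assume (⊆Γ (inj₂ (_ , refl , m , e))))
  ... | inj₁ tra | inj₁ per = inj₁ (tra , per)
  ... | inj₂ d   | _        = inj₂ d
  ... | inj₁ _   | inj₂ d   = inj₂ d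

  access4 : Accessibility 𝒦4
  access4 = record (accessK {𝒦4})
    { _⟶_          = Transmits⁺
    ; _⟶?_         = λ s t → Transmits? s t ×-dec Persists? s t
    ; transmits    = λ _ _ a → All.lookup (proj₁ a)
    ; Seed         = λ s _ → Seed⁺ s
    ; seed-□       = λ s D → □-intro (seed⁺-□ s (λ d → theorem (hyp (ax-4 _)) · d) D)
    ; seed-⟶       = λ s t _ _ D ⊆Γ → seed⁺-⟶ s t D ⊆Γ
    }

  -- `Gains` makes the relation irreflexive. It is compatible with transitivity because a gained box
  -- persists along the next step.
  TransmitsGL : State → State → Set
  TransmitsGL s t = Transmits⁺ s t × Gains s t

  -- By Löb's axiom, `□ q` follows from `□ (□ q ⊃ q)`, so `q` may be derived with `□ q` as an
  -- additional assumption; hence `□ q` joins the seed.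
  accessGL : Accessibility 𝒢ℒ
  accessGL = record (accessK {𝒢ℒ})
    { _⟶_          = TransmitsGL
    ; _⟶?_         = λ s t → (Transmits? s t ×-dec Persists? s t) ×-dec Gains? s t
    ; transmits    = λ _ _ a → All.lookup (proj₁ (proj₁ a))
    ; Seed         = λ s q → Seed⁺ s ∪ ｛ □ q ｝
    ; seed-□       = λ s D d → theorem (hyp (ax-GL _)) · □-intro (seed⁺-□ s 𝒢ℒ-□□ D) (deduction d)
    ; seed-⟶       = seed-⟶GL
    }
    where
    seed-⟶GL : ∀ s t {Γ q} → q ∈ˡ B → s (□ q) ≡ false → Decides 𝒢ℒ Γ keys t →
               Seed⁺ s ∪ ｛ □ q ｝ ⊆ Γ → TransmitsGL s t ⊎ (𝒢ℒ ∣ Γ ▷ ⊥′)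
    seed-⟶GL s t {q = q} m e D ⊆Γ with seed⁺-⟶ s t D (⊆Γ ∘ inj₁) | bool-cases (t (□ q))
    ... | inj₂ d | _         = inj₂ d
    -- The gained box is `□ q` itself, false at `s` and forced at `t` by the seed.
    ... | inj₁ a | inj₁ t□q  = inj₁ (a , lose m (e , t□q))
    ... | inj₁ _ | inj₂ t□q  = inj₂ (literal-false (D (□∈keys m)) t□q · assume (⊆Γ (inj₂ refl)))

  TransmitsGL-trans : ∀ s t v → TransmitsGL s t → TransmitsGL t v → TransmitsGL s v
  TransmitsGL-trans s t v (a , g) (a′@(_ , per′) , _) with find g
  ... | q , m , e , t□q = Transmits⁺-trans s t v a a′ , lose m (e , All.lookup per′ m t□q)

  TransmitsGL-irrefl : ∀ s → ¬ TransmitsGL s s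
  TransmitsGL-irrefl _ (_ , g) with find g
  ... | q , m , e , e′ = contradiction (trans (sym e) e′) λ ()

mainTheorem4 : ∀ {u} (U : Set u) → Infinite U → (p : Formula) →
    ((∀ (F : Frame U) → IsFinite F → F ⊨ p) → ∅ ⊢ p)
    × ((∀ (F : Frame U) → IsFinite F → IsReflexive F → F ⊨ p) → 𝒯 ⊢ p)
    × ((∀ (F : Frame U) → IsFinite F → IsTransitive F → F ⊨ p) → 𝒦4 ⊢ p)
    × ((∀ (F : Frame U) → IsFinite F → IsIrreflexive F → IsTransitive F → F ⊨ p) → 𝒢ℒ ⊢ p)
mainTheorem4 U inf p =
    (λ valid → complete inf p accessK λ f inj i₀ st _ →
      let open Image f inj i₀ st _ _ in valid frame finite)
  , (λ valid → complete inf p accessT λ f inj i₀ st adm →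
      let open Image f inj i₀ st _ _ in valid frame finite (reflexive adm))
  , (λ valid → complete inf p access4 λ f inj i₀ st _ →
      let open Image f inj i₀ st _ _ in valid frame finite (transitive Transmits⁺-trans))
  , (λ valid → complete inf p accessGL λ f inj i₀ st _ →
      let open Image f inj i₀ st _ _ in
      valid frame finite (irreflexive TransmitsGL-irrefl) (transitive TransmitsGL-trans))
  where open Logics p
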